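{- The 0-1 law for typicality degrees of properties of a relational language fails in general: there exist a finite relational first-order language $L$ and a property $\phi(x)$ of $L$ for which neither $d(\phi:\mathrm{typ})=0$ nor $d(\phi:\mathrm{typ})=1$ holds.
   Context: A relational language is one with no function or constant symbols. For a finite language $L$ let $\mathbf{S}_n(L)$ be the set of $L$-structures with universe $\{1,\ldots,n\}$. A property of $L$ is a first-order $L$-formula $\phi(x)$ with one free variable and without parameters; for an $L$-structure $\mathcal{M}$ with universe $M$, $\phi(\mathcal{M})=\{a\in M:\mathcal{M}\models\phi(a)\}$. Let $\mathbf{S}_n(\phi:\mathrm{typ})=\{\mathcal{M}\in\mathbf{S}_n(L):|\phi(\mathcal{M})|>n/2\}$, $d_n(\phi:\mathrm{typ})=|\mathbf{S}_n(\phi:\mathrm{typ})|/|\mathbf{S}_n(L)|$, and $d(\phi:\mathrm{typ})=\lim_{n\to\infty}d_n(\phi:\mathrm{typ})$ whenever this limit exists. The 0-1 law holds for typicality degrees of properties of $L$ if for every $L$-property $\phi(x)$ either $d(\phi:\mathrm{typ})=0$ or $d(\phi:\mathrm{typ})=1$. -}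

module Defs where

open import Data.Bool.Base using (true; false)
open import Data.Fin.Base using (Fin; funToFin)
open import Data.Fin.Properties using (_≟_; all?; any?)
open import Data.Fin.Subset using (Subset; ∣_∣) renaming (_∈_ to _∈ₛ_; ⊥ to ∅)
open import Data.Fin.Subset.Properties using () renaming (_∈?_ to _∈ₛ?_)
open import Data.Empty using (⊥)
open import Data.Integer.Base using (+_)
open import Data.List.Base using (List; []; _∷_; length; filter; cartesianProductWith)
open import Data.List.Membership.Propositional using (_∈_)
open import Data.List.Membership.Propositional.Properties
  using (∈-cartesianProductWith⁺; ∈-length)
open import Data.List.Relation.Unary.All as All using (All; []; _∷_)
import Data.List.Relation.Unary.AllPairs as AllPairs
open import Data.List.Relation.Unary.Any using (here; there)
open import Data.List.Relation.Unary.Unique.Propositional using (Unique)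
open import Data.List.Relation.Unary.Unique.Propositional.Properties
  using (cartesianProductWith⁺)
open import Data.Nat.Base using (ℕ; zero; suc; _*_; _^_; _<_; _≥_; NonZero; >-nonZero)
open import Data.Nat.Properties using (_<?_)
open import Data.Product.Base using (Σ; ∃-syntax; _×_; _,_)
open import Data.Rational.Base as ℚ using (ℚ; 0ℚ)
open import Data.Sum.Base using (_⊎_)
open import Data.Vec.Base as Vec using (Vec; []; _∷_)
open import Relation.Binary.PropositionalEquality using (_≡_; refl)
open import Relation.Nullary using (¬_; Dec; yes; no; does; ¬?; _×-dec_; _⊎-dec_; _→-dec_)

-- The relation symbols are the positions in the list of arities, so several
-- symbols may share an arity.  All arities are at least 1.
record Language : Set where
  field
    arities  : List ℕ
    positive : All NonZero arities

open Language public

-- Formulas whose free variables are among m de Bruijn variables.  There are no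
-- function or constant symbols, so variables are the only terms.
data Formula (L : Language) : ℕ → Set where
  _≐_  : ∀ {m} → Fin m → Fin m → Formula L m
  rel  : ∀ {m a} → a ∈ arities L → Vec (Fin m) a → Formula L m
  ⊥′   : ∀ {m} → Formula L m
  ¬′_  : ∀ {m} → Formula L m → Formula L m
  _∧′_ : ∀ {m} → Formula L m → Formula L m → Formula L m
  _∨′_ : ∀ {m} → Formula L m → Formula L m → Formula L m
  _⇒′_ : ∀ {m} → Formula L m → Formula L m → Formula L m
  ∀′_  : ∀ {m} → Formula L (suc m) → Formula L m
  ∃′_  : ∀ {m} → Formula L (suc m) → Formula L m

Property : Language → Set
Property L = Formula L 1

-- The universe {1,…,n} is represented by Fin n, and an a-ary relation on it by
-- a subset of Fin (n ^ a), where a tuple t : Fin a → Fin n is identified with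
-- its code funToFin t (a bijection, with inverse finToFun).
Interpretation : ℕ → List ℕ → Set
Interpretation n = All (λ a → Subset (n ^ a))

Structure : Language → ℕ → Set
Structure L n = Interpretation n (arities L)

_⊨_[_] : ∀ {L n m} → Structure L n → Formula L m → Vec (Fin n) m → Set
M ⊨ x ≐ y    [ ρ ] = Vec.lookup ρ x ≡ Vec.lookup ρ y
M ⊨ rel R xs [ ρ ] = funToFin (λ i → Vec.lookup ρ (Vec.lookup xs i)) ∈ₛ All.lookup M R
M ⊨ ⊥′       [ ρ ] = ⊥
M ⊨ ¬′ φ     [ ρ ] = ¬ M ⊨ φ [ ρ ]
M ⊨ φ ∧′ ψ   [ ρ ] = M ⊨ φ [ ρ ] × M ⊨ ψ [ ρ ]
M ⊨ φ ∨′ ψ   [ ρ ] = M ⊨ φ [ ρ ] ⊎ M ⊨ ψ [ ρ ]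
M ⊨ φ ⇒′ ψ   [ ρ ] = M ⊨ φ [ ρ ] → M ⊨ ψ [ ρ ]
M ⊨ ∀′ φ     [ ρ ] = ∀ a → M ⊨ φ [ a ∷ ρ ]
M ⊨ ∃′ φ     [ ρ ] = ∃[ a ] M ⊨ φ [ a ∷ ρ ]

_⊨?_[_] : ∀ {L n m} (M : Structure L n) (φ : Formula L m) (ρ : Vec (Fin n) m) →
          Dec (M ⊨ φ [ ρ ])
M ⊨? x ≐ y    [ ρ ] = Vec.lookup ρ x ≟ Vec.lookup ρ y
M ⊨? rel R xs [ ρ ] = funToFin (λ i → Vec.lookup ρ (Vec.lookup xs i)) ∈ₛ? All.lookup M R
M ⊨? ⊥′       [ ρ ] = no λ ()
M ⊨? ¬′ φ     [ ρ ] = ¬? (M ⊨? φ [ ρ ])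
M ⊨? φ ∧′ ψ   [ ρ ] = (M ⊨? φ [ ρ ]) ×-dec (M ⊨? ψ [ ρ ])
M ⊨? φ ∨′ ψ   [ ρ ] = (M ⊨? φ [ ρ ]) ⊎-dec (M ⊨? ψ [ ρ ])
M ⊨? φ ⇒′ ψ   [ ρ ] = (M ⊨? φ [ ρ ]) →-dec (M ⊨? ψ [ ρ ])
M ⊨? ∀′ φ     [ ρ ] = all? λ a → M ⊨? φ [ a ∷ ρ ]
M ⊨? ∃′ φ     [ ρ ] = any? λ a → M ⊨? φ [ a ∷ ρ ]

-- The set φ(M).
extension : ∀ {L n} → Property L → Structure L n → Subset n
extension φ M = Vec.tabulate λ a → does (M ⊨? φ [ a ∷ [] ])

-- |φ(M)| > n/2, cleared of the denominator.
Typical : ∀ {L n} → Property L → Structure L n → Set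
Typical {n = n} φ M = n < 2 * ∣ extension φ M ∣

typical? : ∀ {L n} (φ : Property L) (M : Structure L n) → Dec (Typical φ M)
typical? {n = n} φ M = n <? 2 * ∣ extension φ M ∣

subsets : ∀ k → List (Subset k)
subsets zero    = [] ∷ []
subsets (suc k) = cartesianProductWith _∷_ (true ∷ false ∷ []) (subsets k)

interpretations : ∀ n as → List (Interpretation n as)
interpretations n []       = [] ∷ []
interpretations n (a ∷ as) =
  cartesianProductWith _∷_ (subsets (n ^ a)) (interpretations n as)

-- The set S_n(L), as a list.  By structures-complete and structures-unique
-- below, every structure occurs in it exactly once, so lengths are cardinalities.
structures : ∀ L n → List (Structure L n)
structures L n = interpretations n (arities L)

subsets-complete : ∀ {k} (p : Subset k) → p ∈ subsets k
subsets-complete []          = here refl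
subsets-complete (true  ∷ p) =
  ∈-cartesianProductWith⁺ _∷_ {xs = true ∷ false ∷ []} (here refl) (subsets-complete p)
subsets-complete (false ∷ p) =
  ∈-cartesianProductWith⁺ _∷_ {xs = true ∷ false ∷ []} (there (here refl)) (subsets-complete p)

subsets-unique : ∀ k → Unique (subsets k)
subsets-unique zero    = [] AllPairs.∷ AllPairs.[]
subsets-unique (suc k) = cartesianProductWith⁺ _∷_ (λ { refl → refl , refl })
  (((λ ()) ∷ []) AllPairs.∷ [] AllPairs.∷ AllPairs.[]) (subsets-unique k)

interpretations-complete : ∀ {n as} (M : Interpretation n as) → M ∈ interpretations n as
interpretations-complete []      = here refl
interpretations-complete (p ∷ M) =
  ∈-cartesianProductWith⁺ _∷_ (subsets-complete p) (interpretations-complete M)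

interpretations-unique : ∀ n as → Unique (interpretations n as)
interpretations-unique n []       = [] AllPairs.∷ AllPairs.[]
interpretations-unique n (a ∷ as) = cartesianProductWith⁺ _∷_ (λ { refl → refl , refl })
  (subsets-unique (n ^ a)) (interpretations-unique n as)

structures-complete : ∀ L {n} (M : Structure L n) → M ∈ structures L n
structures-complete L = interpretations-complete

structures-unique : ∀ L n → Unique (structures L n)
structures-unique L n = interpretations-unique n (arities L)

structures-nonZero : ∀ L n → NonZero (length (structures L n))
structures-nonZero L n =
  >-nonZero (∈-length (structures-complete L (All.universal (λ _ → ∅) (arities L))))

typicalStructures : ∀ {L} → Property L → ∀ n → List (Structure L n)
typicalStructures {L} φ n = filter (typical? φ) (structures L n)

-- d_n(φ:typ)
typDegree : ∀ {L} → Property L → ℕ → ℚ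
typDegree {L} φ n =
  ℚ._/_ (+ length (typicalStructures φ n)) (length (structures L n))
        {{structures-nonZero L n}}

-- Rational ε suffice: below every positive real there is a positive rational.
ConvergesTo : (ℕ → ℚ) → ℚ → Set
ConvergesTo s ℓ =
  ∀ ε → 0ℚ ℚ.< ε → ∃[ N ] (∀ n → n ≥ N → ℚ.∣ s n ℚ.- ℓ ∣ ℚ.< ε)

-- "The limit d(φ:typ) exists and equals ℓ."
TypDegreeIs : ∀ {L} → Property L → ℚ → Set
TypDegreeIs φ ℓ = ConvergesTo (typDegree φ) ℓ

{-# OPTIONS --safe #-}

-- Take φ(x) = P(x) for a single unary relation symbol P.  Complementing P is an
-- involution of S_n(L) that complements φ(M), so for odd n it exchanges the
-- structures where φ is typical with those where it is not: d_n(φ:typ) = 1/2.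
module Submission where

open import Defs
open import Data.Bool.Base using (not)
open import Data.Bool.Properties using (not-involutive)
open import Data.Fin.Base using (zero)
open import Data.Fin.Subset using (Subset; ∁; ∣_∣)
open import Data.Fin.Subset.Properties using (x∈∁p⇒x∉p; x∉p⇒x∈∁p; ∣∁p∣≡n∸∣p∣; ∣p∣≤n)
open import Data.Integer.Base as ℤ using (+_)
import Data.Integer.Properties as ℤ
open import Data.List.Base using ([]; _∷_; length; filter; map)
open import Data.List.Membership.Propositional using (_∈_)
open import Data.List.Membership.Propositional.Properties using (∈-map⁺)
open import Data.List.Membership.Propositional.Properties.WithK using (unique∧set⇒bag)
open import Data.List.Properties using (filter-accept; filter-reject)
open import Data.List.Relation.Binary.BagAndSetEquality using (∼bag⇒↭)
open import Data.List.Relation.Binary.Permutation.Propositional using (_↭_)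
open import Data.List.Relation.Binary.Permutation.Propositional.Properties
  using (filter-↭; ↭-length)
open import Data.List.Relation.Unary.All using ([]; _∷_)
open import Data.List.Relation.Unary.Any using (here)
open import Data.List.Relation.Unary.Unique.Propositional using (Unique)
open import Data.List.Relation.Unary.Unique.Propositional.Properties using (map⁺)
open import Data.Nat.Base using (ℕ; suc; _+_; _*_; _<_; NonZero)
open import Data.Nat.Properties
  using (+-identityʳ; +-suc; +-comm; *-comm; +-monoʳ-<; +-cancelˡ-<; <-asym; ≮⇒≥;
         ≤∧≢⇒<; m≤m+n; m≤n⇒m≤1+n; m+[n∸m]≡n; even≢odd)
open import Data.Product.Base using (Σ-syntax; _×_; _,_)
open import Data.Rational.Base as ℚ using (0ℚ; 1ℚ; ½)
import Data.Rational.Properties as ℚ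
open import Data.Rational.Unnormalised.Base using (mkℚᵘ; *≡*)
open import Data.Vec.Base using ([]; _∷_)
open import Data.Vec.Properties as Vec using (tabulate-cong; tabulate-∘)
open import Function.Base using (_∘_)
open import Function.Bundles using (_⇔_; mk⇔; module Equivalence)
open import Function.Definitions using (Injective)
open import Level using (Level)
open import Relation.Binary.PropositionalEquality
open import Relation.Nullary using (¬_; does; yes; no; ¬?)
open import Relation.Nullary.Decidable using (does-⇔; from-yes)
open import Relation.Unary using (Pred; Decidable)

private variable
  a ℓ : Level
  A : Set a
  n : ℕ

module _ {P : Pred A ℓ} (P? : Decidable P) {f : A → A} (P∘f⇔¬P : ∀ x → P (f x) ⇔ (¬ P x)) where

  -- Each `x` is counted exactly once on the left: in the first filter if `P x` holds, and otherwise
  -- through `f x` in the second.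
  filter+filter-map : ∀ xs → length (filter P? xs) + length (filter P? (map f xs)) ≡ length xs
  filter+filter-map []       = refl
  filter+filter-map (x ∷ xs) with P? x
  ... | yes px
    rewrite filter-reject P? {f x} {map f xs} (λ pfx → Equivalence.to (P∘f⇔¬P x) pfx px)
    = cong suc (filter+filter-map xs)
  ... | no ¬px
    rewrite filter-accept P? {f x} {map f xs} (Equivalence.from (P∘f⇔¬P x) ¬px)
    = trans (+-suc _ _) (cong suc (filter+filter-map xs))

module _ {f : A → A} (f-involutive : ∀ x → f (f x) ≡ x) where

  involutive⇒injective : Injective _≡_ _≡_ f
  involutive⇒injective fx≡fy =
    trans (sym (f-involutive _)) (trans (cong f fx≡fy) (f-involutive _))

  -- Both lists enumerate all of `A` without repetition. In a duplicate-free list membership proofs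
  -- are unique, so equality as sets is already equality as bags.
  map-involution-↭ : ∀ {xs} → Unique xs → (∀ x → x ∈ xs) → map f xs ↭ xs
  map-involution-↭ {xs} unique complete =
    ∼bag⇒↭ (unique∧set⇒bag (map⁺ involutive⇒injective unique) unique
      (λ {x} → mk⇔ (λ _ → complete x)
        -- Surjectivity of `f`: `x` is the image of `f x`.
        (λ _ → subst (_∈ map f xs) (f-involutive x) (∈-map⁺ f (complete (f x))))))

  length-filter-half : {P : Pred A ℓ} (P? : Decidable P) → (∀ x → P (f x) ⇔ (¬ P x)) →
                       ∀ {xs} → Unique xs → (∀ x → x ∈ xs) →
                       2 * length (filter P? xs) ≡ length xs
  length-filter-half P? P∘f⇔¬P {xs} unique complete = begin
    2 * k                                  ≡⟨ cong (_+_ k) (+-identityʳ k) ⟩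
    k + k                                  ≡⟨ cong (_+_ k) (↭-length (filter-↭ P? (map-involution-↭ unique complete))) ⟨
    k + length (filter P? (map f xs))      ≡⟨ filter+filter-map P? P∘f⇔¬P xs ⟩
    length xs                              ∎
    where
    open ≡-Reasoning
    k = length (filter P? xs)

-- Two complementary sets cannot both have more than `n / 2` elements. Neither has only in a tie,
-- which odd `n` excludes.
majority-∁ : ∀ m → n ≡ suc (2 * m) → (p : Subset n) →
             n < 2 * ∣ ∁ p ∣ ⇔ (¬ n < 2 * ∣ p ∣)
majority-∁ {n} m n≡1+2m p = mk⇔
  (λ n<2c′ n<2c → <-asym (majority⇒< c c′ c+c′≡n n<2c) (majority⇒< c′ c c′+c≡n n<2c′))
  (λ n≮2c → <⇒majority c′ c c′+c≡n (≤∧≢⇒< (≮⇒≥ (n≮2c ∘ <⇒majority c c′ c+c′≡n)) c≢c′))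
  where
  c  = ∣ p ∣
  c′ = ∣ ∁ p ∣

  c+c′≡n : c + c′ ≡ n
  c+c′≡n = trans (cong (_+_ c) (∣∁p∣≡n∸∣p∣ p)) (m+[n∸m]≡n (∣p∣≤n p))

  c′+c≡n : c′ + c ≡ n
  c′+c≡n = trans (+-comm c′ c) c+c′≡n

  c≢c′ : c ≢ c′
  c≢c′ c≡c′ = even≢odd c m
    -- A tie would make `n` equal to both `2 * c` and `1 + 2 * m`.
    (trans (cong (_+_ c) (trans (+-identityʳ c) c≡c′)) (trans c+c′≡n n≡1+2m))

  majority⇒< : ∀ {n} x y → x + y ≡ n → n < 2 * x → y < x
  -- `2 * x` unfolds to `x + (x + 0)`, so cancelling `x` from `x + y < 2 * x` leaves `y < x + 0`.
  majority⇒< x y refl n<2x = subst (y <_) (+-identityʳ x) (+-cancelˡ-< x y (x + 0) n<2x)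

  <⇒majority : ∀ {n} x y → x + y ≡ n → y < x → n < 2 * x
  <⇒majority x y refl y<x = +-monoʳ-< x (subst (y <_) (sym (+-identityʳ x)) y<x)

∁-involutive : ∀ (p : Subset n) → ∁ (∁ p) ≡ p
∁-involutive p =
  trans (sym (Vec.map-∘ not not p)) (trans (Vec.map-cong not-involutive p) (Vec.map-id p))

unaryLanguage : Language
unaryLanguage = record { arities = 1 ∷ [] ; positive = _ ∷ [] }

unaryProperty : Property unaryLanguage
unaryProperty = rel (here refl) (zero ∷ [])

complement : Structure unaryLanguage n → Structure unaryLanguage n
complement (p ∷ []) = ∁ p ∷ []

complement-involutive : ∀ (M : Structure unaryLanguage n) → complement (complement M) ≡ M
complement-involutive (p ∷ []) = cong (_∷ []) (∁-involutive p)

extension-complement : ∀ (M : Structure unaryLanguage n) →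
                       extension unaryProperty (complement M) ≡ ∁ (extension unaryProperty M)
extension-complement M@(p ∷ []) =
  trans (tabulate-cong λ a → does-⇔ (mk⇔ x∈∁p⇒x∉p x∉p⇒x∈∁p)
          (complement M ⊨? unaryProperty [ a ∷ [] ]) (¬? (M ⊨? unaryProperty [ a ∷ [] ])))
        -- `does (¬? d)` computes to `not (does d)`, and `∁` is the pointwise `not`, so the negation
        -- moves out of `tabulate` as a complement.
        (tabulate-∘ not λ a → does (M ⊨? unaryProperty [ a ∷ [] ]))

typical-complement : ∀ m → n ≡ suc (2 * m) → (M : Structure unaryLanguage n) →
                     Typical unaryProperty (complement M) ⇔ (¬ Typical unaryProperty M)
typical-complement {n} m n≡1+2m M =
  subst (λ q → n < 2 * ∣ q ∣ ⇔ (¬ Typical unaryProperty M))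
    (sym (extension-complement M)) (majority-∁ m n≡1+2m (extension unaryProperty M))

-- `ℚ._/_` reduces to lowest terms, so the equality is checked on unnormalised fractions by
-- cross-multiplication. `mkℚᵘ` stores the denominator minus one, hence `mkℚᵘ (+ 1) 1` is one half.
/≡½ : ∀ k d .{{_ : NonZero d}} → 2 * k ≡ d → + k ℚ./ d ≡ ½
/≡½ k (suc d) 2k≡d = ℚ.fromℚᵘ-cong {mkℚᵘ (+ k) d} {mkℚᵘ (+ 1) 1} (*≡* (begin
  + k ℤ.* + 2      ≡⟨ ℤ.pos-* k 2 ⟨
  + (k * 2)        ≡⟨ cong +_ (trans (*-comm k 2) 2k≡d) ⟩
  + suc d          ≡⟨ ℤ.*-identityˡ (+ suc d) ⟨
  + 1 ℤ.* + suc d  ∎))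
  where open ≡-Reasoning

typDegree-odd : ∀ m → n ≡ suc (2 * m) → typDegree unaryProperty n ≡ ½
typDegree-odd {n} m n≡1+2m =
  /≡½ (length (typicalStructures unaryProperty n)) (length (structures unaryLanguage n))
    {{structures-nonZero unaryLanguage n}}
    (length-filter-half {f = complement} complement-involutive
      (typical? unaryProperty) (typical-complement m n≡1+2m)
      (structures-unique unaryLanguage n) (structures-complete unaryLanguage))

-- Convergence fails for ε = 1/2: at every odd index the distance to `ℓ` is exactly 1/2, never
-- strictly below it.
odd≡½⇒¬convergesTo : ∀ {s} ℓ → (∀ {n} m → n ≡ suc (2 * m) → s n ≡ ½) →
                     ℚ.∣ ½ ℚ.- ℓ ∣ ≡ ½ → ¬ ConvergesTo s ℓ
odd≡½⇒¬convergesTo ℓ odd≡½ ∣½-ℓ∣≡½ converges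
  with N , close ← converges ½ (from-yes (0ℚ ℚ.<? ½)) =
  ℚ.<-irrefl (trans (cong (λ d → ℚ.∣ d ℚ.- ℓ ∣) (odd≡½ N refl)) ∣½-ℓ∣≡½)
    -- `suc (2 * N)` serves as an odd index that is at least `N`.
    (close (suc (2 * N)) (m≤n⇒m≤1+n (m≤m+n N _)))

corollary4p5 : Σ[ L ∈ Language ] Σ[ φ ∈ Property L ] ((¬ TypDegreeIs φ 0ℚ) × (¬ TypDegreeIs φ 1ℚ))
corollary4p5 =
  unaryLanguage , unaryProperty ,
  -- Both 0 and 1 lie at distance 1/2 from 1/2; each `refl` verifies this by computation.
  odd≡½⇒¬convergesTo 0ℚ typDegree-odd refl , odd≡½⇒¬convergesTo 1ℚ typDegree-odd refl
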